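{- Let $d \geq 1$ and let $\Gamma \subset \mathbb{Z}^d \setminus \{\mathbf{0}\}$ be the rule set of a squarefree game in normal play on the board $\mathcal{B} = \mathbb{N}^d$, with set of P-positions $\mathcal{P}$. If $p \in \mathcal{B}$, then $p \in \mathcal{P}$ if and only if $p \cong \mathbf{0}$.
   Context: $\mathbb{N} = \{0,1,2,\ldots\}$. A finite subset $\Gamma \subset \mathbb{Z}^d \setminus \{\mathbf{0}\}$ is a rule set on $\mathbb{N}^d$ if: (a) there is a linear function $\ell : \mathbb{R}^d \to \mathbb{R}$ that is positive on every element of $\Gamma$ and on every nonzero vector of $\mathbb{R}_{\geq 0}^d$; and (b) (tangent cone axiom) for each $i \in \{1,\ldots,d\}$ there is some $\gamma \in \Gamma$ with $\gamma_j \leq 0$ for all $j \neq i$. The game with rule set $\Gamma$ in normal play has board $\mathcal{B} = \mathbb{N}^d$. The options of a position $p \in \mathcal{B}$ are the elements $p - \gamma$ with $\gamma \in \Gamma$ and $p - \gamma \in \mathbb{N}^d$. The board is partitioned as $\mathcal{B} = \mathcal{P} \sqcup \mathcal{N}$ (P-positions and N-positions), determined uniquely by the recursion: $p \in \mathcal{P}$ if and only if every option of $p$ lies in $\mathcal{N}$ (in particular if $p$ has no options), and $p \in \mathcal{N}$ if and only if some option of $p$ lies in $\mathcal{P}$. The game is squarefree if each $\gamma \in \Gamma$ has at most one positive entry, and that entry is at most $1$. For $p, q \in \mathcal{B}$, write $p \cong q$ if for all $r \in \mathbb{N}^d$ one has $p + r \in \mathcal{P}$ if and only if $q + r \in \mathcal{P}$.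 -}

module Defs where

open import Algebra.Bundles using (CommutativeRing)
open import Data.Fin.Base using (Fin)
open import Data.Integer.Base as ℤ using (ℤ; +_)
open import Data.List.Base using (List)
open import Data.List.Membership.Propositional using (_∈_)
open import Data.Nat.Base as ℕ using (ℕ)
import Data.Nat.Properties as ℕ
open import Data.Product.Base using (Σ-syntax; ∃-syntax; _×_; _,_)
open import Data.Rational.Base as ℚ using (ℚ; 0ℚ; 1ℚ)
import Data.Rational.Properties as ℚ
open import Data.Sum.Base using (_⊎_)
open import Data.Vec.Base using (Vec; lookup; map; replicate; zipWith)
open import Function.Bundles using (_⇔_)
open import Relation.Binary.PropositionalEquality
  using (_≡_; _≢_; cong; cong₂)

-- Real numbers are Cauchy sequences of rationals, with _≈_ as their equality.

Eventually : (ℕ → Set) → Set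
Eventually A = Σ[ N ∈ ℕ ] (∀ n → N ℕ.≤ n → A n)

IsCauchy : (ℕ → ℚ) → Set
IsCauchy x = ∀ ε → 0ℚ ℚ.< ε →
  Σ[ N ∈ ℕ ] (∀ m n → N ℕ.≤ m → N ℕ.≤ n → ℚ.∣ x m ℚ.- x n ∣ ℚ.≤ ε)

record ℝ : Set where
  constructor mkℝ
  field
    seq    : ℕ → ℚ
    cauchy : IsCauchy seq

open ℝ public

infix 4 _≈_ _<_ _≤_ _#_

_≈_ : ℝ → ℝ → Set
x ≈ y = ∀ ε → 0ℚ ℚ.< ε → Eventually λ n → ℚ.∣ seq x n ℚ.- seq y n ∣ ℚ.≤ ε

_<_ : ℝ → ℝ → Set
x < y = Σ[ ε ∈ ℚ ] (0ℚ ℚ.< ε × Eventually λ n → seq x n ℚ.+ ε ℚ.≤ seq y n)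

_≤_ : ℝ → ℝ → Set
x ≤ y = ∀ ε → 0ℚ ℚ.< ε → Eventually λ n → seq x n ℚ.≤ seq y n ℚ.+ ε

-- Apartness: classically the negation of _≈_.
_#_ : ℝ → ℝ → Set
x # y = x < y ⊎ y < x

fromℚ : ℚ → ℝ
fromℚ q = mkℝ (λ _ → q) λ ε 0<ε → 0 , λ _ _ _ _ → begin
  ℚ.∣ q ℚ.- q ∣ ≡⟨ cong ℚ.∣_∣ (ℚ.+-inverseʳ q) ⟩
  0ℚ            ≤⟨ ℚ.<⇒≤ 0<ε ⟩
  ε             ∎
  where open ℚ.≤-Reasoning

fromℤ : ℤ → ℝ
fromℤ z = fromℚ (z ℚ./ 1)

0ℝ : ℝ
0ℝ = fromℚ 0ℚ

private
  open ℚ.≤-Reasoning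
  open import Algebra.Properties.CommutativeSemigroup
    (CommutativeRing.+-commutativeSemigroup ℚ.+-*-commutativeRing)
    using (interchange)
  open import Algebra.Properties.Group ℚ.+-0-group using (//-rightDividesˡ)
  open import Algebra.Properties.Ring ℚ.+-*-ring using (x[y-z]≈xy-xz; [y-z]x≈yx-zx)

  abstract
    ∣a∣≤∣a-b∣+∣b∣ : ∀ a b → ℚ.∣ a ∣ ℚ.≤ ℚ.∣ a ℚ.- b ∣ ℚ.+ ℚ.∣ b ∣
    ∣a∣≤∣a-b∣+∣b∣ a b = begin
      ℚ.∣ a ∣                     ≡⟨ cong ℚ.∣_∣ (//-rightDividesˡ b a) ⟨
      ℚ.∣ (a ℚ.- b) ℚ.+ b ∣       ≤⟨ ℚ.∣p+q∣≤∣p∣+∣q∣ (a ℚ.- b) b ⟩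
      ℚ.∣ a ℚ.- b ∣ ℚ.+ ℚ.∣ b ∣   ∎

    +-step : ∀ a b c d → ℚ.∣ (a ℚ.+ b) ℚ.- (c ℚ.+ d) ∣ ℚ.≤ ℚ.∣ a ℚ.- c ∣ ℚ.+ ℚ.∣ b ℚ.- d ∣
    +-step a b c d = begin
      ℚ.∣ (a ℚ.+ b) ℚ.- (c ℚ.+ d) ∣            ≡⟨ cong (λ e → ℚ.∣ (a ℚ.+ b) ℚ.+ e ∣) (ℚ.neg-distrib-+ c d) ⟩
      ℚ.∣ (a ℚ.+ b) ℚ.+ (ℚ.- c ℚ.+ ℚ.- d) ∣    ≡⟨ cong ℚ.∣_∣ (interchange a b (ℚ.- c) (ℚ.- d)) ⟩
      ℚ.∣ (a ℚ.- c) ℚ.+ (b ℚ.- d) ∣            ≤⟨ ℚ.∣p+q∣≤∣p∣+∣q∣ (a ℚ.- c) (b ℚ.- d) ⟩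
      ℚ.∣ a ℚ.- c ∣ ℚ.+ ℚ.∣ b ℚ.- d ∣          ∎

    *-step : ∀ a b c d → a ℚ.* b ℚ.- c ℚ.* d ≡ a ℚ.* (b ℚ.- d) ℚ.+ (a ℚ.- c) ℚ.* d
    *-step a b c d = begin-equality
      a ℚ.* b ℚ.- c ℚ.* d
        ≡⟨ cong (ℚ._- c ℚ.* d) (//-rightDividesˡ (a ℚ.* d) (a ℚ.* b)) ⟨
      ((a ℚ.* b ℚ.- a ℚ.* d) ℚ.+ a ℚ.* d) ℚ.- c ℚ.* d
        ≡⟨ ℚ.+-assoc (a ℚ.* b ℚ.- a ℚ.* d) (a ℚ.* d) (ℚ.- (c ℚ.* d)) ⟩
      (a ℚ.* b ℚ.- a ℚ.* d) ℚ.+ (a ℚ.* d ℚ.- c ℚ.* d)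
        ≡⟨ cong₂ ℚ._+_ (x[y-z]≈xy-xz a b d) ([y-z]x≈yx-zx d a c) ⟨
      a ℚ.* (b ℚ.- d) ℚ.+ (a ℚ.- c) ℚ.* d ∎

    ∣*∣-bound : ∀ {A B} a b → ℚ.∣ a ∣ ℚ.≤ A → ℚ.∣ b ∣ ℚ.≤ B → ℚ.∣ a ℚ.* b ∣ ℚ.≤ A ℚ.* B
    ∣*∣-bound {A} {B} a b ∣a∣≤A ∣b∣≤B = begin
      ℚ.∣ a ℚ.* b ∣
        ≡⟨ ℚ.∣p*q∣≡∣p∣*∣q∣ a b ⟩
      ℚ.∣ a ∣ ℚ.* ℚ.∣ b ∣
        ≤⟨ ℚ.*-monoˡ-≤-nonNeg ℚ.∣ a ∣ {{ℚ.∣-∣-nonNeg a}} ∣b∣≤B ⟩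
      ℚ.∣ a ∣ ℚ.* B
        ≤⟨ ℚ.*-monoʳ-≤-nonNeg B {{ℚ.nonNegative (ℚ.≤-trans (ℚ.0≤∣p∣ b) ∣b∣≤B)}} ∣a∣≤A ⟩
      A ℚ.* B ∎

    *-bound : ∀ {B C δ} a b c d → ℚ.∣ a ∣ ℚ.≤ B → ℚ.∣ d ∣ ℚ.≤ C →
      ℚ.∣ a ℚ.- c ∣ ℚ.≤ δ → ℚ.∣ b ℚ.- d ∣ ℚ.≤ δ →
      ℚ.∣ a ℚ.* b ℚ.- c ℚ.* d ∣ ℚ.≤ (B ℚ.+ C) ℚ.* δ
    *-bound {B} {C} {δ} a b c d ∣a∣≤B ∣d∣≤C ∣a-c∣≤δ ∣b-d∣≤δ = begin
      ℚ.∣ a ℚ.* b ℚ.- c ℚ.* d ∣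
        ≡⟨ cong ℚ.∣_∣ (*-step a b c d) ⟩
      ℚ.∣ a ℚ.* (b ℚ.- d) ℚ.+ (a ℚ.- c) ℚ.* d ∣
        ≤⟨ ℚ.∣p+q∣≤∣p∣+∣q∣ (a ℚ.* (b ℚ.- d)) ((a ℚ.- c) ℚ.* d) ⟩
      ℚ.∣ a ℚ.* (b ℚ.- d) ∣ ℚ.+ ℚ.∣ (a ℚ.- c) ℚ.* d ∣
        ≤⟨ ℚ.+-mono-≤ (∣*∣-bound a (b ℚ.- d) ∣a∣≤B ∣b-d∣≤δ)
                      (∣*∣-bound (a ℚ.- c) d ∣a-c∣≤δ ∣d∣≤C) ⟩
      B ℚ.* δ ℚ.+ δ ℚ.* C
        ≡⟨ cong (B ℚ.* δ ℚ.+_) (ℚ.*-comm δ C) ⟩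
      B ℚ.* δ ℚ.+ C ℚ.* δ
        ≡⟨ ℚ.*-distribʳ-+ δ B C ⟨
      (B ℚ.+ C) ℚ.* δ ∎

    -- Any ε > 0 is K · δ for some δ > 0, given K > 0.
    split : ∀ K → 0ℚ ℚ.< K → ∀ ε → 0ℚ ℚ.< ε → Σ[ δ ∈ ℚ ] (0ℚ ℚ.< δ × K ℚ.* δ ≡ ε)
    split K 0<K ε 0<ε = 1/K ℚ.* ε , ℚ.positive⁻¹ (1/K ℚ.* ε) {{posδ}} , (begin-equality
      K ℚ.* (1/K ℚ.* ε)   ≡⟨ ℚ.*-assoc K 1/K ε ⟨
      K ℚ.* 1/K ℚ.* ε     ≡⟨ cong (ℚ._* ε) (ℚ.*-inverseʳ K {{nonZeroK}}) ⟩
      1ℚ ℚ.* ε            ≡⟨ ℚ.*-identityˡ ε ⟩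
      ε                   ∎)
      where
      posK : ℚ.Positive K
      posK = ℚ.positive 0<K
      nonZeroK : ℚ.NonZero K
      nonZeroK = ℚ.pos⇒nonZero K {{posK}}
      1/K : ℚ
      1/K = ℚ.1/_ K {{nonZeroK}}
      posδ : ℚ.Positive (1/K ℚ.* ε)
      posδ = ℚ.pos*pos⇒pos 1/K {{ℚ.1/pos⇒pos K {{posK}}}} ε {{ℚ.positive 0<ε}}

    bounded : ∀ x → IsCauchy x → Σ[ B ∈ ℚ ] (0ℚ ℚ.< B × Eventually λ n → ℚ.∣ x n ∣ ℚ.≤ B)
    bounded x cx =
      let N , h = cx 1ℚ (ℚ.positive⁻¹ 1ℚ)
      in 1ℚ ℚ.+ ℚ.∣ x N ∣
       , ℚ.positive⁻¹ _ {{ℚ.pos+nonNeg⇒pos 1ℚ ℚ.∣ x N ∣ {{ℚ.∣-∣-nonNeg (x N)}}}}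
       , N
       , λ n N≤n → ℚ.≤-trans (∣a∣≤∣a-b∣+∣b∣ (x n) (x N))
                             (ℚ.+-monoˡ-≤ ℚ.∣ x N ∣ (h n N N≤n ℕ.≤-refl))

    +-cauchy : ∀ x y → IsCauchy x → IsCauchy y → IsCauchy (λ n → x n ℚ.+ y n)
    +-cauchy x y cx cy ε 0<ε =
      let δ , 0<δ , 2δ≡ε = split (1ℚ ℚ.+ 1ℚ) (ℚ.positive⁻¹ (1ℚ ℚ.+ 1ℚ)) ε 0<ε
          M , hx = cx δ 0<δ
          N , hy = cy δ 0<δ
      in M ℕ.⊔ N , λ m n ≤m ≤n → begin
        ℚ.∣ (x m ℚ.+ y m) ℚ.- (x n ℚ.+ y n) ∣
          ≤⟨ +-step (x m) (y m) (x n) (y n) ⟩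
        ℚ.∣ x m ℚ.- x n ∣ ℚ.+ ℚ.∣ y m ℚ.- y n ∣
          ≤⟨ ℚ.+-mono-≤ (hx m n (ℕ.m⊔n≤o⇒m≤o M N ≤m) (ℕ.m⊔n≤o⇒m≤o M N ≤n))
                        (hy m n (ℕ.m⊔n≤o⇒n≤o M N ≤m) (ℕ.m⊔n≤o⇒n≤o M N ≤n)) ⟩
        δ ℚ.+ δ
          ≡⟨ cong₂ ℚ._+_ (ℚ.*-identityˡ δ) (ℚ.*-identityˡ δ) ⟨
        1ℚ ℚ.* δ ℚ.+ 1ℚ ℚ.* δ
          ≡⟨ ℚ.*-distribʳ-+ δ 1ℚ 1ℚ ⟨
        (1ℚ ℚ.+ 1ℚ) ℚ.* δ
          ≡⟨ 2δ≡ε ⟩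
        ε ∎

    *-cauchy : ∀ x y → IsCauchy x → IsCauchy y → IsCauchy (λ n → x n ℚ.* y n)
    *-cauchy x y cx cy ε 0<ε =
      let B , 0<B , K , hB = bounded x cx
          C , 0<C , L , hC = bounded y cy
          δ , 0<δ , [B+C]δ≡ε = split (B ℚ.+ C) (ℚ.+-mono-< 0<B 0<C) ε 0<ε
          M , hx = cx δ 0<δ
          N , hy = cy δ 0<δ
          left : ∀ {o} → K ℕ.⊔ L ℕ.⊔ (M ℕ.⊔ N) ℕ.≤ o → K ℕ.⊔ L ℕ.≤ o
          left = ℕ.m⊔n≤o⇒m≤o (K ℕ.⊔ L) (M ℕ.⊔ N)
          right : ∀ {o} → K ℕ.⊔ L ℕ.⊔ (M ℕ.⊔ N) ℕ.≤ o → M ℕ.⊔ N ℕ.≤ o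
          right = ℕ.m⊔n≤o⇒n≤o (K ℕ.⊔ L) (M ℕ.⊔ N)
      in K ℕ.⊔ L ℕ.⊔ (M ℕ.⊔ N) , λ m n ≤m ≤n → ℚ.≤-trans
        (*-bound (x m) (y m) (x n) (y n)
          (hB m (ℕ.m⊔n≤o⇒m≤o K L (left ≤m)))
          (hC n (ℕ.m⊔n≤o⇒n≤o K L (left ≤n)))
          (hx m n (ℕ.m⊔n≤o⇒m≤o M N (right ≤m)) (ℕ.m⊔n≤o⇒m≤o M N (right ≤n)))
          (hy m n (ℕ.m⊔n≤o⇒n≤o M N (right ≤m)) (ℕ.m⊔n≤o⇒n≤o M N (right ≤n))))
        (ℚ.≤-reflexive [B+C]δ≡ε)

infixl 6 _+_
infixl 7 _*_

_+_ : ℝ → ℝ → ℝ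
mkℝ x cx + mkℝ y cy = mkℝ (λ n → x n ℚ.+ y n) (+-cauchy x y cx cy)

_*_ : ℝ → ℝ → ℝ
mkℝ x cx * mkℝ y cy = mkℝ (λ n → x n ℚ.* y n) (*-cauchy x y cx cy)

ℝ^ : ℕ → Set
ℝ^ d = Fin d → ℝ

record IsLinear {d} (ℓ : ℝ^ d → ℝ) : Set where
  field
    resp-≈      : ∀ {u v} → (∀ i → u i ≈ v i) → ℓ u ≈ ℓ v
    additive    : ∀ u v → ℓ (λ i → u i + v i) ≈ ℓ u + ℓ v
    homogeneous : ∀ c v → ℓ (λ i → c * v i) ≈ c * ℓ v

fromℤᵈ : ∀ {d} → Vec ℤ d → ℝ^ d
fromℤᵈ γ i = fromℤ (lookup γ i)

-- A finite subset of ℤᵈ is given by a list of its elements; order and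
-- repetitions play no role.

-- "Nonzero" for a real vector is stated with apartness: from v ≉ 0 alone
-- one cannot constructively produce a positive entry of v ≥ 0.
record PositiveFunctional {d} (Γ : List (Vec ℤ d)) : Set where
  field
    ℓ               : ℝ^ d → ℝ
    linear          : IsLinear ℓ
    positiveOnRules : ∀ γ → γ ∈ Γ → 0ℝ < ℓ (fromℤᵈ γ)
    positiveOnCone  : ∀ v → (∀ i → 0ℝ ≤ v i) → (∃[ i ] v i # 0ℝ) → 0ℝ < ℓ v

record IsRuleSet {d} (Γ : List (Vec ℤ d)) : Set where
  field
    nonzero            : ∀ γ → γ ∈ Γ → γ ≢ replicate d (+ 0)
    positiveFunctional : PositiveFunctional Γ
    tangentCone        : ∀ i → ∃[ γ ] (γ ∈ Γ × (∀ j → j ≢ i → lookup γ j ℤ.≤ + 0))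

record IsSquarefree {d} (Γ : List (Vec ℤ d)) : Set where
  field
    atMostOnePositive : ∀ γ → γ ∈ Γ → ∀ i j →
      + 0 ℤ.< lookup γ i → + 0 ℤ.< lookup γ j → i ≡ j
    positive⇒≤1       : ∀ γ → γ ∈ Γ → ∀ i →
      + 0 ℤ.< lookup γ i → lookup γ i ℤ.≤ + 1

Board : ℕ → Set
Board d = Vec ℕ d

origin : ∀ {d} → Board d
origin {d} = replicate d 0

infixl 6 _⊕_

_⊕_ : ∀ {d} → Board d → Board d → Board d
_⊕_ = zipWith ℕ._+_

module Game {d} (Γ : List (Vec ℤ d)) where

  _IsOptionOf_ : Board d → Board d → Set
  q IsOptionOf p = ∃[ γ ] (γ ∈ Γ × map +_ q ≡ zipWith ℤ._-_ (map +_ p) γ)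

  -- The least solution of the recursion for P- and N-positions. For a rule
  -- set, ℓ bounds the length of every play, so the solution is unique.
  mutual
    data 𝒫 (p : Board d) : Set where
      isP : (∀ q → q IsOptionOf p → 𝒩 q) → 𝒫 p

    data 𝒩 (p : Board d) : Set where
      isN : ∀ q → q IsOptionOf p → 𝒫 q → 𝒩 p

  infix 4 _≅_

  _≅_ : Board d → Board d → Set
  p ≅ q = ∀ r → 𝒫 (p ⊕ r) ⇔ 𝒫 (q ⊕ r)

{-# OPTIONS --safe #-}

-- In a squarefree game every rule subtracts a single unit from one coordinate
-- and adds to others, so p ⊕ r is played as the disjunctive sum of p and r.
-- A P-position p can then be removed from p ⊕ r: each move in p
-- has an answer in p that returns to a P-position.  All inductions are on the
-- derivations of 𝒫 and 𝒩, so determinacy of the game is not needed.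
-- The functional ℓ serves only to show that no rule is ≤ 0 everywhere, so that
-- the origin has no options.

module Submission where

open import Defs
open import Data.Fin.Base using (Fin)
import Data.Fin.Properties as Fin
open import Data.Integer.Base as ℤ using (ℤ; +_; +[1+_]; -[1+_])
import Data.Integer.Properties as ℤ
open import Data.List.Base using (List)
open import Data.List.Membership.Propositional using (_∈_)
open import Data.Nat.Base as ℕ using (ℕ; suc)
import Data.Nat.Properties as ℕ
open import Data.Product.Base using (∃-syntax; _×_; _,_)
open import Data.Rational.Base as ℚ using (ℚ; 0ℚ; 1ℚ)
import Data.Rational.Properties as ℚ
open import Data.Sum.Base using (_⊎_; inj₁; inj₂)
open import Data.Vec.Base using (Vec; lookup; map; tabulate; zipWith)
open import Data.Vec.Properties
  using (lookup-map; lookup-replicate; lookup-zipWith; lookup∘tabulate;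
         tabulate-cong; tabulate∘lookup; zipWith-comm; zipWith-identityˡ)
open import Function.Bundles using (_⇔_; mk⇔; Equivalence)
open import Relation.Binary.PropositionalEquality
  using (_≡_; refl; sym; trans; cong; cong₂; subst; module ≡-Reasoning)
open import Relation.Nullary using (¬_; yes; no; contradiction)
open import Algebra.Properties.CommutativeSemigroup ℤ.+-commutativeSemigroup
  using (xy∙z≈xz∙y)

lookup-ext : ∀ {a} {A : Set a} {n} {u v : Vec A n} →
  (∀ i → lookup u i ≡ lookup v i) → u ≡ v
lookup-ext {u = u} {v} u≗v =
  trans (sym (tabulate∘lookup u)) (trans (tabulate-cong u≗v) (tabulate∘lookup v))

-1ℚ : ℚ
-1ℚ = ℚ.- 1ℚ

0<-1*neg : ∀ n → 0ℚ ℚ.< -1ℚ ℚ.* (-[1+ n ] ℚ./ 1)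
0<-1*neg n = ℚ.positive⁻¹ _
  {{ℚ.neg*neg⇒pos -1ℚ (-[1+ n ] ℚ./ 1)
    -- `-[1+ n ] ℚ./ 1` computes to `ℚ.- m`, so its sign comes from that of `m`.
    {{ℚ.negative (ℚ.neg-antimono-< (ℚ.positive⁻¹ m {{ℚ.normalize-pos (suc n) 1}}))}}}}
  where
  m : ℚ
  m = +[1+ n ] ℚ./ 1

0≤-1*nonPos : ∀ {z} → z ℤ.≤ + 0 → 0ℚ ℚ.≤ -1ℚ ℚ.* (z ℚ./ 1)
0≤-1*nonPos { + 0}      _ = ℚ.≤-refl
0≤-1*nonPos {+[1+ n ]} (ℤ.+≤+ ())
0≤-1*nonPos { -[1+ n ]} _ = ℚ.<⇒≤ (0<-1*neg n)

0<x⇒0≮-x : ∀ {x y} → 0ℝ < x → 0ℝ < y → ¬ (y ≈ fromℚ -1ℚ * x)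
0<x⇒0≮-x {x} {y} (δ , 0<δ , K , x≥δ) (ε , 0<ε , L , y≥ε) y≈-x =
  -- The tolerance is the lower bound `ε` of `y` itself; the bound `δ` on `x` then makes the
  -- distance `b + a` exceed it strictly.
  let M , close = y≈-x ε 0<ε
      n = K ℕ.⊔ (L ℕ.⊔ M)
      a = seq x n
      b = seq y n
      K≤n = ℕ.m≤m⊔n K (L ℕ.⊔ M)
      L⊔M≤n = ℕ.m≤n⊔m K (L ℕ.⊔ M)
      -[-1*a]≡a : ℚ.- (-1ℚ ℚ.* a) ≡ a
      -[-1*a]≡a = trans (ℚ.neg-distribˡ-* -1ℚ a) (ℚ.*-identityˡ a)
      open ℚ.≤-Reasoning
  in ℚ.<-irrefl refl (begin-strict
    ε                            ≡⟨ ℚ.+-identityʳ ε ⟨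
    ε ℚ.+ 0ℚ                     <⟨ ℚ.+-monoʳ-< ε 0<δ ⟩
    ε ℚ.+ δ                      ≡⟨ cong₂ ℚ._+_ (ℚ.+-identityˡ ε) (ℚ.+-identityˡ δ) ⟨
    (0ℚ ℚ.+ ε) ℚ.+ (0ℚ ℚ.+ δ)    ≤⟨ ℚ.+-mono-≤ (y≥ε n (ℕ.m⊔n≤o⇒m≤o L M L⊔M≤n)) (x≥δ n K≤n) ⟩
    b ℚ.+ a                      ≡⟨ cong (b ℚ.+_) -[-1*a]≡a ⟨
    b ℚ.- -1ℚ ℚ.* a              ≤⟨ p≤∣p∣ (b ℚ.- -1ℚ ℚ.* a) ⟩
    ℚ.∣ b ℚ.- -1ℚ ℚ.* a ∣        ≤⟨ close n (ℕ.m⊔n≤o⇒n≤o L M L⊔M≤n) ⟩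
    ε                            ∎)
  where
  p≤∣p∣ : ∀ p → p ℚ.≤ ℚ.∣ p ∣
  p≤∣p∣ p with ℚ.≤-total 0ℚ p
  ... | inj₁ 0≤p = ℚ.≤-reflexive (sym (ℚ.0≤p⇒∣p∣≡p 0≤p))
  ... | inj₂ p≤0 = ℚ.≤-trans p≤0 (ℚ.0≤∣p∣ p)

-- If γ ≤ 0, then -γ is a nonzero vector of the cone, so `ℓ` is positive on both γ and -γ, against
-- homogeneity.
rule≰0 : ∀ {d} {Γ : List (Vec ℤ d)} → IsRuleSet Γ →
  ∀ γ → γ ∈ Γ → ¬ (∀ i → lookup γ i ℤ.≤ + 0)
rule≰0 {d} Γ-rules γ γ∈Γ γ≤0 =
  0<x⇒0≮-x {ℓ (fromℤᵈ γ)} {ℓ -γ} (positiveOnRules γ γ∈Γ)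
    (positiveOnCone -γ
      (λ i ε 0<ε → 0 , λ n _ →
        ℚ.≤-trans (0≤-1*nonPos (γ≤0 i)) (p≤p+ε (seq (-γ i) n) 0<ε))
      -γ#0)
    (IsLinear.homogeneous linear (fromℚ -1ℚ) (fromℤᵈ γ))
  where
  open IsRuleSet Γ-rules
  open PositiveFunctional positiveFunctional

  -γ : ℝ^ d
  -γ i = fromℚ -1ℚ * fromℤᵈ γ i

  p≤p+ε : ∀ p {ε} → 0ℚ ℚ.< ε → p ℚ.≤ p ℚ.+ ε
  p≤p+ε p {ε} 0<ε =
    subst (ℚ._≤ p ℚ.+ ε) (ℚ.+-identityʳ p) (ℚ.+-monoʳ-≤ p (ℚ.<⇒≤ 0<ε))

  -z#0 : ∀ {z} → z ℤ.< + 0 → fromℚ -1ℚ * fromℤ z # 0ℝ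
  -z#0 { -[1+ n ]} _ = inj₂ (_ , 0<-1*neg n , 0 , λ _ _ → ℚ.≤-reflexive (ℚ.+-identityˡ _))
  -z#0 {+[1+ n ]} (ℤ.+<+ ())

  -γ#0 : ∃[ i ] -γ i # 0ℝ
  -- The entries are integers, so a negative one can be searched for; this yields the apartness that
  -- `positiveOnCone` demands.
  -γ#0 with Fin.any? (λ i → lookup γ i ℤ.<? + 0)
  ... | yes (i , γᵢ<0) = i , -z#0 γᵢ<0
  ... | no γ≮0 = contradiction
    (lookup-ext λ i → trans (ℤ.≤-antisym (γ≤0 i) (ℤ.≮⇒≥ λ γᵢ<0 → γ≮0 (i , γᵢ<0)))
                            (sym (lookup-replicate i (+ 0))))
    (nonzero γ γ∈Γ)

⊕-comm : ∀ {d} (p r : Board d) → p ⊕ r ≡ r ⊕ p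
⊕-comm = zipWith-comm ℕ.+-comm

-- The equation in `IsOptionOf`, read one coordinate at a time.
Subtracts : ∀ {d} → Vec ℤ d → Board d → Board d → Set
Subtracts γ p q = ∀ i → + lookup q i ≡ + lookup p i ℤ.- lookup γ i

module _ {d} (γ : Vec ℤ d) where

  subtract⇒Subtracts : ∀ p q → map +_ q ≡ zipWith ℤ._-_ (map +_ p) γ → Subtracts γ p q
  subtract⇒Subtracts p q eq i = begin
    + lookup q i                                ≡⟨ lookup-map i +_ q ⟨
    lookup (map +_ q) i                         ≡⟨ cong (λ v → lookup v i) eq ⟩
    lookup (zipWith ℤ._-_ (map +_ p) γ) i       ≡⟨ lookup-zipWith ℤ._-_ i (map +_ p) γ ⟩
    lookup (map +_ p) i ℤ.- lookup γ i          ≡⟨ cong (ℤ._- lookup γ i) (lookup-map i +_ p) ⟩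
    + lookup p i ℤ.- lookup γ i                 ∎
    where open ≡-Reasoning

  Subtracts⇒subtract : ∀ p q → Subtracts γ p q → map +_ q ≡ zipWith ℤ._-_ (map +_ p) γ
  Subtracts⇒subtract p q h = lookup-ext λ i → begin
    lookup (map +_ q) i                         ≡⟨ lookup-map i +_ q ⟩
    + lookup q i                                ≡⟨ h i ⟩
    + lookup p i ℤ.- lookup γ i                 ≡⟨ cong (ℤ._- lookup γ i) (lookup-map i +_ p) ⟨
    lookup (map +_ p) i ℤ.- lookup γ i          ≡⟨ lookup-zipWith ℤ._-_ i (map +_ p) γ ⟨
    lookup (zipWith ℤ._-_ (map +_ p) γ) i       ∎
    where open ≡-Reasoning

  Subtracts⇒≤ : ∀ {p q} → Subtracts γ p q → ∀ i → lookup γ i ℤ.≤ + lookup p i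
  Subtracts⇒≤ h i = ℤ.0≤i-j⇒j≤i (subst (+ 0 ℤ.≤_) (h i) (ℤ.+≤+ ℕ.z≤n))

  ≤⇒Subtracts : ∀ p → (∀ i → lookup γ i ℤ.≤ + lookup p i) → ∃[ q ] Subtracts γ p q
  ≤⇒Subtracts p γ≤p = tabulate difference , λ i →
    trans (cong +_ (lookup∘tabulate difference i)) (ℤ.0≤i⇒+∣i∣≡i (ℤ.i≤j⇒0≤j-i (γ≤p i)))
    where
    difference : Fin d → ℕ
    -- The absolute value only changes the type: `γ≤p` makes the difference nonnegative.
    difference i = ℤ.∣ + lookup p i ℤ.- lookup γ i ∣

  Subtracts-⊕ʳ : ∀ {p q} r → Subtracts γ p q → Subtracts γ (p ⊕ r) (q ⊕ r)
  Subtracts-⊕ʳ {p} {q} r h i = begin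
    + lookup (q ⊕ r) i                              ≡⟨ cong +_ (lookup-zipWith ℕ._+_ i q r) ⟩
    + lookup q i ℤ.+ + lookup r i                   ≡⟨ cong (ℤ._+ + lookup r i) (h i) ⟩
    + lookup p i ℤ.- lookup γ i ℤ.+ + lookup r i    ≡⟨ xy∙z≈xz∙y (+ lookup p i) (ℤ.- lookup γ i) (+ lookup r i) ⟩
    + lookup p i ℤ.+ + lookup r i ℤ.- lookup γ i    ≡⟨ cong (λ n → + n ℤ.- lookup γ i) (lookup-zipWith ℕ._+_ i p r) ⟨
    + lookup (p ⊕ r) i ℤ.- lookup γ i               ∎
    where open ≡-Reasoning

  Subtracts-functional : ∀ {p q q′} → Subtracts γ p q → Subtracts γ p q′ → q ≡ q′
  Subtracts-functional h h′ = lookup-ext λ i → ℤ.+-injective (trans (h i) (sym (h′ i)))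

module _ {d} {Γ : List (Vec ℤ d)} where
  open Game Γ

  option-⊕ʳ : ∀ {p q} r → q IsOptionOf p → (q ⊕ r) IsOptionOf (p ⊕ r)
  option-⊕ʳ {p} {q} r (γ , γ∈Γ , eq) =
    γ , γ∈Γ , Subtracts⇒subtract γ (p ⊕ r) (q ⊕ r)
                (Subtracts-⊕ʳ γ {p} {q} r (subtract⇒Subtracts γ p q eq))

  option-⊕ˡ : ∀ p {r q} → q IsOptionOf r → (p ⊕ q) IsOptionOf (p ⊕ r)
  option-⊕ˡ p {r} {q} o rewrite ⊕-comm p r | ⊕-comm p q = option-⊕ʳ p o

  -- Playing γ in `p` alone and then adding `r` solves the same equation as `q`, and its solution is
  -- unique.
  ≤⇒option-⊕ : ∀ {γ} → γ ∈ Γ → ∀ p r {q} → Subtracts γ (p ⊕ r) q →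
    (∀ i → lookup γ i ℤ.≤ + lookup p i) → ∃[ p′ ] (p′ IsOptionOf p × q ≡ p′ ⊕ r)
  ≤⇒option-⊕ {γ} γ∈Γ p r {q} h γ≤p =
    let p′ , h′ = ≤⇒Subtracts γ p γ≤p
    in p′ , (γ , γ∈Γ , Subtracts⇒subtract γ p p′ h′)
          , Subtracts-functional γ {p ⊕ r} h (Subtracts-⊕ʳ γ {p} {p′} r h′)

module _ {d} {Γ : List (Vec ℤ d)} (squarefree : IsSquarefree Γ) where
  open Game Γ
  open IsSquarefree squarefree

  -- If γ does not fit below p at the coordinate i, then γᵢ = 1 and pᵢ = 0, so
  -- the unit γ removes from p ⊕ r lies in r.
  rule≤summand : ∀ γ → γ ∈ Γ → ∀ p r → (∀ i → lookup γ i ℤ.≤ + lookup (p ⊕ r) i) →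
    (∀ i → lookup γ i ℤ.≤ + lookup p i) ⊎ (∀ i → lookup γ i ℤ.≤ + lookup r i)
  rule≤summand γ γ∈Γ p r γ≤p⊕r with Fin.all? (λ i → lookup γ i ℤ.≤? + lookup p i)
  ... | yes γ≤p = inj₁ γ≤p
  ... | no γ≰p with Fin.¬∀⟶∃¬ d _ (λ i → lookup γ i ℤ.≤? + lookup p i) γ≰p
  ...   | i , γᵢ≰pᵢ = inj₂ γ≤r
    where
    pᵢ<γᵢ : + lookup p i ℤ.< lookup γ i
    pᵢ<γᵢ = ℤ.≰⇒> γᵢ≰pᵢ

    0<γᵢ : + 0 ℤ.< lookup γ i
    0<γᵢ = ℤ.≤-<-trans (ℤ.+≤+ ℕ.z≤n) pᵢ<γᵢ

    pᵢ≡0 : lookup p i ≡ 0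
    pᵢ≡0 = ℕ.n<1⇒n≡0 (ℤ.drop‿+<+ (ℤ.<-≤-trans pᵢ<γᵢ (positive⇒≤1 γ γ∈Γ i 0<γᵢ)))

    γ≤r : ∀ j → lookup γ j ℤ.≤ + lookup r j
    γ≤r j with + 0 ℤ.<? lookup γ j
    ... | no γⱼ≯0 = ℤ.≤-trans (ℤ.≮⇒≥ γⱼ≯0) (ℤ.+≤+ ℕ.z≤n)
    ... | yes 0<γⱼ with refl ← atMostOnePositive γ γ∈Γ i j 0<γᵢ 0<γⱼ =
      subst (λ n → lookup γ i ℤ.≤ + n)
        (trans (lookup-zipWith ℕ._+_ i p r) (cong (ℕ._+ lookup r i) pᵢ≡0))
        (γ≤p⊕r i)

  -- Converse to `option-⊕ʳ` and `option-⊕ˡ`; squarefreeness enters through `rule≤summand`.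
  option-⊕⁻ : ∀ p r {q} → q IsOptionOf (p ⊕ r) →
    (∃[ p′ ] (p′ IsOptionOf p × q ≡ p′ ⊕ r)) ⊎ (∃[ r′ ] (r′ IsOptionOf r × q ≡ p ⊕ r′))
  option-⊕⁻ p r {q} (γ , γ∈Γ , eq)
    with h ← subtract⇒Subtracts γ (p ⊕ r) q eq
    with rule≤summand γ γ∈Γ p r (Subtracts⇒≤ γ {p ⊕ r} {q} h)
  ... | inj₁ γ≤p = inj₁ (≤⇒option-⊕ γ∈Γ p r h γ≤p)
  ... | inj₂ γ≤r =
    let r′ , o , q≡r′⊕p = ≤⇒option-⊕ γ∈Γ r p (subst (λ s → Subtracts γ s q) (⊕-comm p r) h) γ≤r
    in inj₂ (r′ , o , trans q≡r′⊕p (⊕-comm r′ p))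

  -- Each move is answered in the summand where it was made. Every call shrinks one derivation and
  -- keeps the other.
  𝒫-⊕ : ∀ {p r} → 𝒫 p → 𝒫 r → 𝒫 (p ⊕ r)
  𝒫-⊕ {p} {r} (isP p→𝒩) (isP r→𝒩) = isP λ q o → moves q (option-⊕⁻ p r o)
    where
    moves : ∀ q → (∃[ p′ ] (p′ IsOptionOf p × q ≡ p′ ⊕ r)) ⊎
                  (∃[ r′ ] (r′ IsOptionOf r × q ≡ p ⊕ r′)) → 𝒩 q
    moves _ (inj₁ (p′ , o , refl)) with p→𝒩 p′ o
    ... | isN p″ o′ p″∈𝒫 = isN (p″ ⊕ r) (option-⊕ʳ r o′) (𝒫-⊕ p″∈𝒫 (isP r→𝒩))
    moves _ (inj₂ (r′ , o , refl)) with r→𝒩 r′ o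
    ... | isN r″ o′ r″∈𝒫 = isN (p ⊕ r″) (option-⊕ˡ p o′) (𝒫-⊕ (isP p→𝒩) r″∈𝒫)

  mutual
    𝒫-cancelˡ : ∀ {p r} → 𝒫 p → 𝒫 (p ⊕ r) → 𝒫 r
    𝒫-cancelˡ {p} p∈𝒫 (isP p⊕r→𝒩) =
      isP λ r′ o → 𝒩-cancelˡ p∈𝒫 (p⊕r→𝒩 (p ⊕ r′) (option-⊕ˡ p o))

    -- A winning move made in `r` still wins after cancelling `p`. One made in `p` has an answer
    -- `p″` in 𝒫, and `p″ ⊕ r` is again in 𝒩, with `r` untouched.
    𝒩-cancelˡ : ∀ {p r} → 𝒫 p → 𝒩 (p ⊕ r) → 𝒩 r
    𝒩-cancelˡ {p} {r} (isP p→𝒩) (isN q o q∈𝒫) with option-⊕⁻ p r o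
    𝒩-cancelˡ {p} {r} (isP p→𝒩) (isN _ _ q∈𝒫) | inj₂ (r′ , o , refl) =
      isN r′ o (𝒫-cancelˡ (isP p→𝒩) q∈𝒫)
    -- Opening the derivation for `q` exhibits the one for `p″ ⊕ r` as smaller, so the recursion
    -- terminates.
    𝒩-cancelˡ {p} {r} (isP p→𝒩) (isN _ _ (isP q→𝒩)) | inj₁ (p′ , o , refl)
      with p→𝒩 p′ o
    ... | isN p″ o′ p″∈𝒫 = 𝒩-cancelˡ p″∈𝒫 (q→𝒩 (p″ ⊕ r) (option-⊕ʳ r o′))

-- A move from the origin would need a rule that is ≤ 0 everywhere.
origin∈𝒫 : ∀ {d} {Γ : List (Vec ℤ d)} → IsRuleSet Γ → Game.𝒫 Γ origin
origin∈𝒫 Γ-rules = Game.isP λ q (γ , γ∈Γ , eq) → contradiction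
  (λ i → subst (λ n → lookup γ i ℤ.≤ + n) (lookup-replicate i 0)
           (Subtracts⇒≤ γ {origin} {q} (subtract⇒Subtracts γ origin q eq) i))
  (rule≰0 Γ-rules γ γ∈Γ)

proposition2 : (d : ℕ) → 1 ℕ.≤ d → (Γ : List (Vec ℤ d)) → IsRuleSet Γ → IsSquarefree Γ →
    (p : Board d) → Game.𝒫 Γ p ⇔ Game._≅_ Γ p origin
proposition2 d 1≤d Γ Γ-rules squarefree p = mk⇔ 𝒫⇒≅ ≅⇒𝒫
  where
  open Game Γ

  origin-⊕ : ∀ r → origin ⊕ r ≡ r
  origin-⊕ = zipWith-identityˡ ℕ.+-identityˡ

  𝒫⇒≅ : 𝒫 p → p ≅ origin
  𝒫⇒≅ p∈𝒫 r rewrite origin-⊕ r = mk⇔ (𝒫-cancelˡ squarefree p∈𝒫) (𝒫-⊕ squarefree p∈𝒫)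

  ≅⇒𝒫 : p ≅ origin → 𝒫 p
  ≅⇒𝒫 p≅0 = subst 𝒫 (trans (⊕-comm p origin) (origin-⊕ p))
    -- Testing the equivalence at `r = origin` suffices.
    (Equivalence.from (p≅0 origin) (subst 𝒫 (sym (origin-⊕ origin)) (origin∈𝒫 Γ-rules)))
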